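{- Let $k>1$ be a parameter. The communication complexity of constructing a $(4k-2)$-spanner in weighted undirected distributed graphs on $n$ vertices with edges observed at $s$ sites (edge weights in $[1,w]$, with $w$ polynomial in $n$) under the blackboard model, with or without duplication, is $\tilde{O}(s+n^{1+1/k})$. In unweighted graphs, the stretch factor can be reduced to $2k-1$ (that is, a $(2k-1)$-spanner can be constructed within the same communication bound).
   Context: Distributed graph: there are $s$ sites $S_1,\dots,S_s$ with a common vertex set $V$, $|V|=n$; site $S_j$ holds a subset $E_j\subseteq E$ of the edges (with their weights), where $E=\bigcup_{j=1}^s E_j$. Without duplication, the sets $E_j$ are pairwise disjoint; with duplication, they may have non-empty intersections. Blackboard model: sites communicate with each other through a shared blackboard (such as a broadcast channel), whose contents are visible to all. The communication cost is the total number of bits communicated; the communication complexity of a problem is the communication cost needed to solve it. Spanner: an $\alpha$-spanner of $G=(V,E,W)$ is a subgraph $H=(V,E')$, $E'\subseteq E$, with $d_H(u,v)\le \alpha\, d_G(u,v)$ for all $u,v\in V$, where $d$ denotes shortest-path distance (every edge has length $1$ in the unweighted case); $\alpha$ is called the stretch factor. $\tilde{O}$ hides a polylogarithmic factor.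
   Formalization: The edge weights, and the bound w on them, are rational numbers instead of real numbers. -}

module Defs where

open import Data.Bool using (Bool; true; false; if_then_else_)
open import Data.Empty using (⊥)
open import Data.Fin using (Fin)
open import Data.Integer using (+_)
open import Data.Maybe using (Maybe; just; nothing)
open import Data.Nat using (ℕ; zero; suc)
import Data.Nat as ℕ
open import Data.Nat.Logarithm using (⌈log₂_⌉)
open import Data.Product using (Σ-syntax; ∃; ∃-syntax; _×_)
open import Data.Rational using (ℚ; 0ℚ; 1ℚ; _+_; _*_; _≤_; _/_)
open import Data.Unit using (⊤)
open import Relation.Binary.PropositionalEquality using (_≡_; _≢_; refl; cong₂)

fromℕ : ℕ → ℚ
fromℕ m = + m / 1

------------------------------------------------------------------------
-- Graphs and spanners

-- A weighted undirected simple graph on the vertex set Fin n.  The edge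
-- set and the weights are given together: weight? u v is nothing when uv
-- is not an edge, so a graph carries no weights outside its edge set.

record WGraph (n : ℕ) : Set where
  field
    weight?  : Fin n → Fin n → Maybe ℚ
    sym      : ∀ u v → weight? u v ≡ weight? v u
    loopless : ∀ u → weight? u u ≡ nothing

open WGraph public using (weight?)

_[_—_]≡_ : ∀ {n} → WGraph n → Fin n → Fin n → ℚ → Set
G [ u — v ]≡ x = weight? G u v ≡ just x

Edge : ∀ {n} → WGraph n → Fin n → Fin n → Set
Edge G u v = ∃[ x ] G [ u — v ]≡ x

_⊆ᴳ_ : ∀ {n} → WGraph n → WGraph n → Set
H ⊆ᴳ G = ∀ u v x → H [ u — v ]≡ x → G [ u — v ]≡ x

record EdgeSet (n : ℕ) : Set where
  field
    member : Fin n → Fin n → Bool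
    sym    : ∀ u v → member u v ≡ member v u

open EdgeSet public using (member)

_⊆ᴱ_ : ∀ {n} → EdgeSet n → WGraph n → Set
E′ ⊆ᴱ G = ∀ u v → member E′ u v ≡ true → Edge G u v

-- The subgraph (V , E′), with the weights inherited from G.

subgraph : ∀ {n} → WGraph n → EdgeSet n → WGraph n
subgraph G E′ = record
  { weight?  = λ u v → if member E′ u v then weight? G u v else nothing
  ; sym      = λ u v → cong₂ (λ b x → if b then x else nothing)
                             (EdgeSet.sym E′ u v) (WGraph.sym G u v)
  ; loopless = λ u → noLoop (member E′ u u) (WGraph.loopless G u)
  }
  where
  noLoop : ∀ b {x : Maybe ℚ} → x ≡ nothing →
           (if b then x else nothing) ≡ nothing
  noLoop true  eq = eq
  noLoop false _  = refl

data Walk {n} (G : WGraph n) : Fin n → Fin n → Set where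
  []  : ∀ {u} → Walk G u u
  _∷_ : ∀ {u v t x} → G [ u — v ]≡ x → Walk G v t → Walk G u t

length : ∀ {n} {G : WGraph n} {u v} → Walk G u v → ℚ
length []                = 0ℚ
length (_∷_ {x = x} _ p) = x + length p

-- d is the shortest-path distance from u to v.  All weights considered
-- are at least 1, so walks and simple paths give the same minimum.
-- No d satisfies this when u and v are disconnected (infinite distance).

IsDistance : ∀ {n} → WGraph n → Fin n → Fin n → ℚ → Set
IsDistance G u v d =
  (Σ[ p ∈ Walk G u v ] length p ≡ d) × (∀ (p : Walk G u v) → d ≤ length p)

-- If d_G(u,v) is infinite, d_H(u,v) ≤ α d_G(u,v) holds trivially; if it
-- is finite, then d_H(u,v) has to be finite as well.

IsSpanner : ∀ {n} → ℚ → WGraph n → EdgeSet n → Set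
IsSpanner α G E′ =
  E′ ⊆ᴱ G ×
  (∀ u v d → IsDistance G u v d →
     ∃[ d′ ] IsDistance (subgraph G E′) u v d′ × d′ ≤ α * d)

WeightsIn[1,_] : ℚ → ∀ {n} → WGraph n → Set
WeightsIn[1, w ] G = ∀ u v x → G [ u — v ]≡ x → 1ℚ ≤ x × x ≤ w

Unweighted : ∀ {n} → WGraph n → Set
Unweighted G = ∀ u v x → G [ u — v ]≡ x → x ≡ 1ℚ

------------------------------------------------------------------------
-- Distributed graphs

record DistributedGraph (n s : ℕ) : Set where
  field
    graph : WGraph n
    site  : Fin s → WGraph n
    site⊆ : ∀ j → site j ⊆ᴳ graph
    cover : ∀ u v → Edge graph u v → ∃[ j ] Edge (site j) u v

open DistributedGraph public using (graph; site)

data Duplication : Set where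
  withDuplication withoutDuplication : Duplication

Respects : Duplication → ∀ {n s} → DistributedGraph n s → Set
Respects withDuplication    D = ⊤
Respects withoutDuplication D =
  ∀ i j → i ≢ j → ∀ u v → Edge (site D i) u v → Edge (site D j) u v → ⊥

------------------------------------------------------------------------
-- Blackboard protocols

-- A node of the tree is a state of the blackboard.  The blackboard
-- determines which site writes next; the bit written depends only on the
-- blackboard and that site's own edges.  The output is read off the
-- final blackboard.

data Protocol (n s : ℕ) : Set where
  output : EdgeSet n → Protocol n s
  write  : (j : Fin s) → (WGraph n → Bool) → (Bool → Protocol n s) →
           Protocol n s

result : ∀ {n s} → Protocol n s → (Fin s → WGraph n) → EdgeSet n
result (output E′)    _ = E′
result (write j f π)  X = result (π (f (X j))) X

cost : ∀ {n s} → Protocol n s → (Fin s → WGraph n) → ℕ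
cost (output _)     _ = zero
cost (write j f π)  X = suc (cost (π (f (X j))) X)

-- The communication complexity of constructing an α-spanner of n-vertex
-- graphs in the class P, distributed over s sites, is at most b bits
-- (deterministic protocols, worst-case cost).

SpannerComplexity≤ : Duplication → (n s : ℕ) → (WGraph n → Set) → ℚ → ℕ → Set
SpannerComplexity≤ δ n s P α b =
  Σ[ π ∈ Protocol n s ]
    (∀ (D : DistributedGraph n s) → Respects δ D → P (graph D) →
       IsSpanner α (graph D) (result π (site D)) × cost π (site D) ℕ.≤ b)

------------------------------------------------------------------------
-- Asymptotics

PolynomiallyBounded : (ℕ → ℚ) → Set
PolynomiallyBounded w =
  ∃[ A ] ∃[ a ] (∀ n → 1 ℕ.≤ n → w n ≤ fromℕ (A ℕ.* n ℕ.^ a))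

-- b ≤ M (s + n^(1+1/k)) as real numbers, for k ≥ 1: the second condition
-- says t ≤ M n^(1+1/k), raised to the k-th power.

_≤_·⟨_+_^⟨1+1/_⟩⟩ : (b M s n k : ℕ) → Set
b ≤ M ·⟨ s + n ^⟨1+1/ k ⟩⟩ =
  ∃[ t ] b ℕ.≤ M ℕ.* s ℕ.+ t × t ℕ.^ k ℕ.≤ M ℕ.^ k ℕ.* n ℕ.^ suc k

-- Complexity≤ k n s b is an upper bound b for parameters k, n, s.  The
-- hidden factor C (1 + ⌈log₂ n⌉)^c is polylogarithmic in n, and C and c
-- do not depend on k, n, s.

Õ⟨s+n^⟨1+1/k⟩⟩ : ((k n s b : ℕ) → Set) → Set
Õ⟨s+n^⟨1+1/k⟩⟩ Complexity≤ =
  ∃[ C ] ∃[ c ] (∀ k n s → 1 ℕ.< k →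
    ∃[ b ] Complexity≤ k n s b ×
           b ≤ C ℕ.* suc ⌈log₂ n ⌉ ℕ.^ c ·⟨ s + n ^⟨1+1/ k ⟩⟩)

{-# OPTIONS --safe #-}

-- Sites take turns, going through the weight scales 1, 2, 4, …, to write
-- on the blackboard an edge whose endpoints are more than 2k − 1 edges
-- apart in the graph F written so far.  An edge that is never written is
-- bypassed by at most 2k − 1 edges that are at most twice as heavy.
--
-- To bound the size of F, count walks that traverse edges in the order in
-- which they were written.  A new edge uv turns those that end at u into
-- walks ending at v and vice versa, and as u and v are far apart, all
-- walks of at most k edges ending at a given vertex start at different
-- vertices.  If A (j , v) is the number of walks of at most j edges that
-- end at v, and n ≤ d ^ k, then for each new edge one of the kn numbers
-- min (⌊A (j + 1 , v) / d ^ j⌋ , d) grows, so F has at most k n d edges.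
module Submission where

open import Defs
open import Data.Bool using (true; false)
open import Data.Bool.Properties using (∨-comm)
open import Data.Empty using (⊥-elim)
open import Data.Fin as Fin
  using (Fin; toℕ; fromℕ<; inject≤; combine; remQuot; quotient; remainder)
open import Data.Fin.Properties as Fin using (2↔Bool; injective⇒≤) renaming (_≟_ to _≟ᶠ_)
open import Data.List as List using (List; []; _∷_; _++_; map)
open import Data.List.Membership.Propositional using (_∈_)
open import Data.List.Membership.Propositional.Properties
open import Data.List.Properties using (length-++; length-upTo; length-tabulate; length-map)
open import Data.List.Relation.Unary.All as All using (All; []; _∷_)
import Data.List.Relation.Unary.All.Properties as All
open import Data.List.Relation.Unary.AllPairs using (AllPairs; []; _∷_)
import Data.List.Relation.Unary.AllPairs.Properties as AllPairs
open import Data.List.Relation.Unary.Any using (here; there; any?)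
open import Data.List.Relation.Unary.Unique.Propositional using (Unique)
import Data.List.Relation.Unary.Unique.Propositional.Properties as Unique
open import Data.Maybe using (Maybe; just; nothing; maybe)
open import Data.Maybe.Properties using (just-injective)
open import Data.Product using (Σ-syntax; ∃-syntax; _×_; _,_; proj₁; proj₂; uncurry)
open import Data.Product.Properties using (≡-dec)
open import Data.Sum using (_⊎_; inj₁; inj₂; swap; [_,_]′)
open import Function using (_∘_; id; _on_; Inverse)
open import Level using (0ℓ)
open import Relation.Binary using (Rel; Decidable; Symmetric; _⇒_; DecTotalOrder)
open import Relation.Binary.PropositionalEquality
open import Relation.Nullary
  using (¬_; Dec; yes; no; does; proof; invert; Reflects; contradiction; ¬?)
open import Relation.Nullary.Decidable
  using (map′; _×-dec_; _⊎-dec_; decidable-stable; dec-true)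

-- Greedy edge lists

module Counting where

  open import Data.Nat
  open import Data.Nat.DivMod using (_/_; /-monoˡ-≤; +-distrib-/-∣ʳ; n/n≡1; m<n*o⇒m/o<n)
  open import Data.Nat.Divisibility using (∣-refl)
  open import Data.Nat.ListAction using (sum)
  open import Data.Nat.Properties

  -- The index only bounds the number of steps from above: `stay` is available at every `h`.
  data Near {V : Set} (A : Rel V 0ℓ) : ℕ → Rel V 0ℓ where
    stay : ∀ {h v} → Near A h v v
    step : ∀ {h u v t} → A u v → Near A h v t → Near A (suc h) u t

  near-map : ∀ {V : Set} {A B : Rel V 0ℓ} {h} → A ⇒ B → Near A h ⇒ Near B h
  near-map f stay       = stay
  near-map f (step a p) = step (f a) (near-map f p)

  near-≤ : ∀ {V : Set} {A : Rel V 0ℓ} {g h} → g ≤ h → Near A g ⇒ Near A h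
  near-≤ g≤h       stay       = stay
  near-≤ (s≤s g≤h) (step a p) = step a (near-≤ g≤h p)

  near-trans : ∀ {V : Set} {A : Rel V 0ℓ} {g h u v t} →
               Near A g u v → Near A h v t → Near A (g + h) u t
  near-trans {g = g} stay q = near-≤ (m≤n+m _ g) q
  near-trans (step a p)   q = step a (near-trans p q)

  near-sym : ∀ {V : Set} {A : Rel V 0ℓ} {h} → Symmetric A → Symmetric (Near A h)
  near-sym A-sym stay = stay
  near-sym {h = suc h} A-sym (step a p) =
    near-≤ (≤-reflexive (+-comm h 1))
           (near-trans (near-sym A-sym p) (step {h = 0} (A-sym a) stay))

  -- Lets a site compute which edges to write, and later turns "not far" into "near".
  near? : ∀ {n} {A : Rel (Fin n) 0ℓ} → Decidable A → ∀ h → Decidable (Near A h)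
  near? A? zero u v = map′ (λ { refl → stay }) (λ { stay → refl }) (u ≟ᶠ v)
  near? A? (suc h) u v =
    map′ (λ { (inj₁ refl) → stay ; (inj₂ (w , a , p)) → step a p })
         (λ { stay → inj₁ refl ; (step a p) → inj₂ (_ , a , p) })
         (u ≟ᶠ v ⊎-dec Fin.any? (λ w → A? u w ×-dec near? A? h w v))

  unique-length : ∀ {n} {xs : List (Fin n)} → Unique xs → List.length xs ≤ n
  unique-length xs! = injective⇒≤ (lookup-injective xs!)
    where
    lookup-injective : ∀ {n} {xs : List (Fin n)} → Unique xs →
                       ∀ {i j} → List.lookup xs i ≡ List.lookup xs j → i ≡ j
    lookup-injective (_ ∷ _) {Fin.zero} {Fin.zero} _ = refl
    lookup-injective (x∉ ∷ _) {Fin.zero} {Fin.suc j} eq = ⊥-elim (All.lookup x∉ (∈-lookup j) eq)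
    lookup-injective (x∉ ∷ _) {Fin.suc i} {Fin.zero} eq = ⊥-elim (All.lookup x∉ (∈-lookup i) (sym eq))
    lookup-injective (_ ∷ xs!) {Fin.suc i} {Fin.suc j} eq = cong Fin.suc (lookup-injective xs! eq)

  sum-mono : ∀ {A : Set} {f g : A → ℕ} → (∀ x → f x ≤ g x) →
             ∀ xs → sum (map f xs) ≤ sum (map g xs)
  sum-mono f≤g []       = z≤n
  sum-mono f≤g (x ∷ xs) = +-mono-≤ (f≤g x) (sum-mono f≤g xs)

  sum-mono-< : ∀ {A : Set} {f g : A → ℕ} {x} {xs} → (∀ x → f x ≤ g x) →
               x ∈ xs → f x < g x → sum (map f xs) < sum (map g xs)
  sum-mono-< {xs = _ ∷ xs} f≤g (here refl) fx<gx = +-mono-<-≤ fx<gx (sum-mono f≤g xs)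
  sum-mono-< {xs = y ∷ _}  f≤g (there x∈)  fx<gx = +-mono-≤-< (f≤g y) (sum-mono-< f≤g x∈ fx<gx)

  sum-≤ : ∀ {A : Set} {f : A → ℕ} {d} → (∀ x → f x ≤ d) →
          ∀ xs → sum (map f xs) ≤ List.length xs * d
  sum-≤ f≤d []       = z≤n
  sum-≤ f≤d (x ∷ xs) = +-mono-≤ (f≤d x) (sum-≤ f≤d xs)

  length-cartesianProduct : ∀ {A B : Set} (xs : List A) (ys : List B) →
    List.length (List.cartesianProduct xs ys) ≡ List.length xs * List.length ys
  length-cartesianProduct []       ys = refl
  length-cartesianProduct (x ∷ xs) ys =
    trans (length-++ (map (x ,_) ys))
          (cong₂ _+_ (length-map (x ,_) ys) (length-cartesianProduct xs ys))

  module _ {n : ℕ} where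

    Adj : List (Fin n × Fin n) → Rel (Fin n) 0ℓ
    Adj F u v = (u , v) ∈ F ⊎ (v , u) ∈ F

    adj-there : ∀ {e F} → Adj F ⇒ Adj (e ∷ F)
    adj-there = [ inj₁ ∘ there , inj₂ ∘ there ]′

    -- The newest edge is at the head, and its endpoints are far apart in the tail, the graph at the
    -- time of insertion. Hence the edges form no cycle of at most `h + 1` edges.
    data Greedy (h : ℕ) : List (Fin n × Fin n) → Set where
      []  : Greedy h []
      _∷_ : ∀ {u v F} → ¬ Near (Adj F) h u v → Greedy h F → Greedy h ((u , v) ∷ F)

    greedy-≢ : ∀ {h u v F} → ¬ Near (Adj F) h u v → u ≢ v
    greedy-≢ far refl = far stay

    -- A walk in order of insertion can use the newest edge only as its last one. So the new walks
    -- to `x` are the old ones to `y` prolonged by that edge, and vice versa.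
    extend : Fin n × Fin n → (Fin n → List (Fin n)) → Fin n → List (Fin n)
    extend (x , y) S v with v ≟ᶠ x | v ≟ᶠ y
    ... | yes _ | _     = S y
    ... | no _  | yes _ = S x
    ... | no _  | no _  = []

    -- The start vertices of the walks of at most j edges that end at v and
    -- traverse edges in the order of their insertion into F.
    sources : List (Fin n × Fin n) → ℕ → Fin n → List (Fin n)
    sources []      _       v = v ∷ []
    sources (e ∷ F) zero    v = v ∷ []
    sources (e ∷ F) (suc j) v = sources F (suc j) v ++ extend e (sources F j) v

    sources-near : ∀ F j v {z} → z ∈ sources F j v → Near (Adj F) j v z
    sources-near []      j    v (here refl) = stay
    sources-near (e ∷ F) zero v (here refl) = stay
    sources-near ((x , y) ∷ F) (suc j) v z∈ with ∈-++⁻ (sources F (suc j) v) z∈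
    ... | inj₁ z∈F = near-map adj-there (sources-near F (suc j) v z∈F)
    ... | inj₂ z∈ext with v ≟ᶠ x | v ≟ᶠ y
    ...   | yes refl | _        =
            step (inj₁ (here refl)) (near-map adj-there (sources-near F j y z∈ext))
    ...   | no _     | yes refl =
            step (inj₂ (here refl)) (near-map adj-there (sources-near F j x z∈ext))
    ...   | no _     | no _ with () ← z∈ext

    -- Two walks ending at an endpoint of a new edge, one of them through
    -- that edge, start at different vertices: otherwise the endpoints of
    -- the edge would have been near each other.
    sources-unique : ∀ {κ F} → Greedy (suc (κ + κ)) F →
                     ∀ j v → j ≤ suc κ → Unique (sources F j v)
    sources-unique []          j       v _ = [] ∷ []
    sources-unique (far ∷ grd) zero    v _ = [] ∷ []
    sources-unique {κ} {(x , y) ∷ F} (far ∷ grd) (suc j) v (s≤s j≤κ) =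
      Unique.++⁺ (sources-unique grd (suc j) v (s≤s j≤κ)) new! disjoint
      where
      new! : Unique (extend (x , y) (sources F j) v)
      new! with v ≟ᶠ x | v ≟ᶠ y
      ... | yes _ | _     = sources-unique grd j y (m≤n⇒m≤1+n j≤κ)
      ... | no _  | yes _ = sources-unique grd j x (m≤n⇒m≤1+n j≤κ)
      ... | no _  | no _  = []

      disjoint : ∀ {z} → ¬ (z ∈ sources F (suc j) v × z ∈ extend (x , y) (sources F j) v)
      disjoint (z∈v , z∈ext) with v ≟ᶠ x | v ≟ᶠ y
      -- One walk has at most `j + 1` edges and the other at most `j`, which is at most `2κ + 1` in
      -- all.
      ... | yes refl | _ = far (near-≤ (s≤s (+-mono-≤ j≤κ j≤κ))
        (near-trans (sources-near F (suc j) v z∈v) (near-sym swap (sources-near F j y z∈ext))))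
      ... | no _ | yes refl = far (near-≤ (s≤s (+-mono-≤ j≤κ j≤κ)) (near-sym swap
        (near-trans (sources-near F (suc j) v z∈v) (near-sym swap (sources-near F j x z∈ext)))))
      ... | no _ | no _ with () ← z∈ext

    sources-≥1 : ∀ F j v → 1 ≤ List.length (sources F j v)
    sources-≥1 []      j       v = ≤-refl
    sources-≥1 (e ∷ F) zero    v = ≤-refl
    sources-≥1 (e ∷ F) (suc j) v = begin
      1                                ≤⟨ sources-≥1 F (suc j) v ⟩
      List.length (sources F (suc j) v) ≤⟨ m≤m+n _ _ ⟩
      List.length (sources F (suc j) v) + List.length (extend e (sources F j) v)
        ≡⟨ length-++ (sources F (suc j) v) ⟨
      List.length (sources (e ∷ F) (suc j) v) ∎
      where open ≤-Reasoning

    -- Potential function bounding the number of edges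

    module _ (κ d : ℕ) .{{_ : NonZero d}} where

      reach : List (Fin n × Fin n) → ℕ → Fin n → ℕ
      reach F j v = List.length (sources F j v)

      reach-left : ∀ x y F j → reach ((x , y) ∷ F) (suc j) x ≡ reach F (suc j) x + reach F j y
      reach-left x y F j = trans (length-++ (sources F (suc j) x))
        (cong (λ zs → reach F (suc j) x + List.length zs) eq)
        where
        eq : extend (x , y) (sources F j) x ≡ sources F j y
        eq with x ≟ᶠ x
        ... | yes _  = refl
        ... | no x≢x = contradiction refl x≢x

      reach-right : ∀ {x y} F j → x ≢ y →
                    reach ((x , y) ∷ F) (suc j) y ≡ reach F (suc j) y + reach F j x
      reach-right {x} {y} F j x≢y = trans (length-++ (sources F (suc j) y))
        (cong (λ zs → reach F (suc j) y + List.length zs) eq)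
        where
        eq : extend (x , y) (sources F j) y ≡ sources F j x
        eq with y ≟ᶠ x | y ≟ᶠ y
        ... | yes y≡x | _      = contradiction (sym y≡x) x≢y
        ... | no _    | yes _  = refl
        ... | no _    | no y≢y = contradiction refl y≢y

      -- Division by `d ^ j` makes `d ^ j` new walks worth one unit; the cap `d` bounds the total
      -- over all indices.
      level : List (Fin n × Fin n) → ℕ × Fin n → ℕ
      level F (j , v) = _/_ (reach F (suc j) v) (d ^ j) {{m^n≢0 d j}} ⊓ d

      level-mono : ∀ e F i → level F i ≤ level (e ∷ F) i
      level-mono e F (j , v) = ⊓-monoˡ-≤ d (/-monoˡ-≤ (d ^ j) {{m^n≢0 d j}}
        (subst (reach F (suc j) v ≤_) (sym (length-++ (sources F (suc j) v))) (m≤m+n _ _)))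

      -- At least `d ^ j` new walks raise the quotient by one, and as the old quotient is below `d`,
      -- the cap does not swallow the increase.
      level-gain : ∀ {e F j v b} → reach (e ∷ F) (suc j) v ≡ reach F (suc j) v + b →
                   d ^ j ≤ b → reach F (suc j) v < d ^ suc j → level F (j , v) < level (e ∷ F) (j , v)
      level-gain {e} {F} {j} {v} {b} eq d^j≤b small = begin-strict
        q ⊓ d                         ≤⟨ m⊓n≤m q d ⟩
        q                             <⟨ ⊓-glb gain q<d ⟩
        (reach (e ∷ F) (suc j) v / d ^ j) ⊓ d ∎
        where
        open ≤-Reasoning
        instance
          d^j≢0 : NonZero (d ^ j)
          d^j≢0 = m^n≢0 d j
        q : ℕ
        q = reach F (suc j) v / d ^ j
        q<d : q < d
        q<d = m<n*o⇒m/o<n {n = d} small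
        gain : suc q ≤ reach (e ∷ F) (suc j) v / d ^ j
        gain = begin
          suc q                               ≡⟨ +-comm 1 q ⟩
          q + 1                               ≡⟨ cong (q +_) (n/n≡1 (d ^ j)) ⟨
          q + d ^ j / d ^ j                   ≡⟨ +-distrib-/-∣ʳ (reach F (suc j) v) (∣-refl {d ^ j}) ⟨
          (reach F (suc j) v + d ^ j) / d ^ j     ≤⟨ /-monoˡ-≤ (d ^ j) (+-monoʳ-≤ (reach F (suc j) v) d^j≤b) ⟩
          (reach F (suc j) v + b) / d ^ j         ≡⟨ cong (_/ d ^ j) eq ⟨
          reach (e ∷ F) (suc j) v / d ^ j         ∎

      Gain : Fin n × Fin n → List (Fin n × Fin n) → Set
      Gain e F = ∃[ j ] ∃[ v ] j < suc κ × level F (j , v) < level (e ∷ F) (j , v)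

      -- Induction on `i`: each endpoint receives the at least `d ^ i` walks of the other one.
      -- Either this raises its level, or it already had `d ^ (i + 1)` walks.
      gain-or-large : ∀ {x y} F → x ≢ y → ∀ i → i ≤ suc κ →
                      Gain (x , y) F ⊎ (d ^ i ≤ reach F i x × d ^ i ≤ reach F i y)
      gain-or-large {x} {y} F x≢y zero _ = inj₂ (sources-≥1 F zero x , sources-≥1 F zero y)
      gain-or-large {x} {y} F x≢y (suc i) i<k with gain-or-large F x≢y i (<⇒≤ i<k)
      ... | inj₁ g = inj₁ g
      ... | inj₂ (x-large , y-large) with d ^ suc i ≤? reach F (suc i) x | d ^ suc i ≤? reach F (suc i) y
      ...   | no small | _ =
              inj₁ (i , x , i<k , level-gain {e = x , y} {F} (reach-left x y F i) y-large (≰⇒> small))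
      ...   | yes _ | no small =
              inj₁ (i , y , i<k , level-gain {e = x , y} {F} (reach-right F i x≢y) x-large (≰⇒> small))
      ...   | yes p | yes q = inj₂ (p , q)

      -- Without a gain, `x` already had at least `n` walks; the new edge brings one more, so that
      -- more than `n` distinct vertices would be sources.
      greedy-gain : ∀ {e F} → n ≤ d ^ suc κ → Greedy (suc (κ + κ)) (e ∷ F) → Gain e F
      greedy-gain {x , y} {F} n≤d^k grd@(far ∷ _) with gain-or-large F (greedy-≢ far) (suc κ) ≤-refl
      ... | inj₁ g = g
      ... | inj₂ (x-large , _) = contradiction (begin-strict
        n                            ≤⟨ n≤d^k ⟩
        d ^ suc κ                    ≤⟨ x-large ⟩
        reach F (suc κ) x                <⟨ m<m+n _ (sources-≥1 F κ y) ⟩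
        reach F (suc κ) x + reach F κ y      ≡⟨ reach-left x y F κ ⟨
        reach ((x , y) ∷ F) (suc κ) x    ≤⟨ unique-length (sources-unique grd (suc κ) x ≤-refl) ⟩
        n                            ∎) (<-irrefl refl)
        where open ≤-Reasoning

      indices : List (ℕ × Fin n)
      indices = List.cartesianProduct (List.upTo (suc κ)) (List.allFin n)

      -- Every insertion raises the sum of the levels by at least one, and each of the `(κ + 1) n`
      -- levels is at most `d`.
      greedy-length : ∀ {F} → n ≤ d ^ suc κ → Greedy (suc (κ + κ)) F →
                      List.length F ≤ suc κ * n * d
      greedy-length {F} n≤d^k grd = begin
        List.length F                 ≤⟨ potential grd ⟩
        sum (map (level F) indices)   ≤⟨ sum-≤ (λ _ → m⊓n≤n _ d) indices ⟩
        List.length indices * d       ≡⟨ cong (_* d) (length-cartesianProduct (List.upTo (suc κ)) (List.allFin n)) ⟩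
        List.length (List.upTo (suc κ)) * List.length (List.allFin n) * d
          ≡⟨ cong₂ (λ p q → p * q * d) (length-upTo (suc κ)) (length-tabulate {n = n} _) ⟩
        suc κ * n * d                 ∎
        where
        open ≤-Reasoning
        potential : ∀ {F} → Greedy (suc (κ + κ)) F → List.length F ≤ sum (map (level F) indices)
        potential [] = z≤n
        potential {e ∷ F} grd@(_ ∷ grd′) =
          let _ , v , j<k , gain = greedy-gain n≤d^k grd in
          <-≤-trans (s≤s (potential grd′))
            (sum-mono-< (level-mono e F) (∈-cartesianProduct⁺ (∈-upTo⁺ j<k) (∈-allFin v)) gain)

-- Walks and distances

module Distances where

  open Counting
  open import Data.Integer as ℤ using (-[1+_])
  import Data.Integer.Properties as ℤ
  open import Data.Nat as ℕ using (ℕ; zero; suc; z≤n; s≤s)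
  import Data.Nat.Properties as ℕ
  open import Data.Rational
  open import Data.Rational.Properties as ℚ using (module ≤-Reasoning)
  open import Data.Rational.Unnormalised as ℚᵘ using (mkℚᵘ; *≡*; *≤*)
  import Data.Rational.Unnormalised.Properties as ℚᵘ
  open import Data.List.Extrema (DecTotalOrder.totalOrder ℚ.≤-decTotalOrder)
    using (argmin; f[argmin]≤f[⊤]; f[argmin]≤f[xs])

  -- `fromℕ` goes through a division that normalises. Facts about it are therefore proved for
  -- unnormalised fractions, where the denominator 1 is visible.
  toℚᵘ-fromℕ : ∀ m → toℚᵘ (fromℕ m) ℚᵘ.≃ mkℚᵘ (ℤ.+ m) 0
  toℚᵘ-fromℕ m = ℚ.toℚᵘ-fromℚᵘ (mkℚᵘ (ℤ.+ m) 0)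

  fromℕ-mono : ∀ {m n} → m ℕ.≤ n → fromℕ m ≤ fromℕ n
  fromℕ-mono {m} {n} m≤n = ℚ.toℚᵘ-cancel-≤ (begin
    toℚᵘ (fromℕ m)  ≃⟨ toℚᵘ-fromℕ m ⟩
    mkℚᵘ (ℤ.+ m) 0    ≤⟨ *≤* (ℤ.*-monoʳ-≤-nonNeg (ℤ.+ 1) (ℤ.+≤+ m≤n)) ⟩
    mkℚᵘ (ℤ.+ n) 0    ≃⟨ toℚᵘ-fromℕ n ⟨
    toℚᵘ (fromℕ n)  ∎)
    where open ℚᵘ.≤-Reasoning

  fromℕ-+ : ∀ m n → fromℕ (m ℕ.+ n) ≡ fromℕ m + fromℕ n
  fromℕ-+ m n = ℚ.toℚᵘ-injective (begin
    toℚᵘ (fromℕ (m ℕ.+ n))              ≈⟨ toℚᵘ-fromℕ (m ℕ.+ n) ⟩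
    mkℚᵘ (ℤ.+ (m ℕ.+ n)) 0                ≈⟨ *≡* (cong (ℤ._* ℤ.1ℤ) (trans (ℤ.pos-+ m n)
                                             (sym (cong₂ ℤ._+_ (ℤ.*-identityʳ (ℤ.+ m)) (ℤ.*-identityʳ (ℤ.+ n)))))) ⟩
    mkℚᵘ (ℤ.+ m) 0 ℚᵘ.+ mkℚᵘ (ℤ.+ n) 0      ≈⟨ ℚᵘ.+-cong (toℚᵘ-fromℕ m) (toℚᵘ-fromℕ n) ⟨
    toℚᵘ (fromℕ m) ℚᵘ.+ toℚᵘ (fromℕ n)  ≈⟨ ℚ.toℚᵘ-homo-+ (fromℕ m) (fromℕ n) ⟨
    toℚᵘ (fromℕ m + fromℕ n)            ∎)
    where open ℚᵘ.≃-Reasoning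

  fromℕ-* : ∀ m n → fromℕ (m ℕ.* n) ≡ fromℕ m * fromℕ n
  fromℕ-* m n = ℚ.toℚᵘ-injective (begin
    toℚᵘ (fromℕ (m ℕ.* n))              ≈⟨ toℚᵘ-fromℕ (m ℕ.* n) ⟩
    mkℚᵘ (ℤ.+ (m ℕ.* n)) 0                ≈⟨ *≡* (cong (ℤ._* ℤ.1ℤ) (ℤ.pos-* m n)) ⟩
    mkℚᵘ (ℤ.+ m) 0 ℚᵘ.* mkℚᵘ (ℤ.+ n) 0      ≈⟨ ℚᵘ.*-cong (toℚᵘ-fromℕ m) (toℚᵘ-fromℕ n) ⟨
    toℚᵘ (fromℕ m) ℚᵘ.* toℚᵘ (fromℕ n)  ≈⟨ ℚ.toℚᵘ-homo-* (fromℕ m) (fromℕ n) ⟨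
    toℚᵘ (fromℕ m * fromℕ n)            ∎)
    where open ℚᵘ.≃-Reasoning

  fromℕ-nonNeg : ∀ m → NonNegative (fromℕ m)
  fromℕ-nonNeg m = nonNegative (fromℕ-mono (z≤n {m}))

  archimedean : ∀ p → ∃[ N ] p ≤ fromℕ N
  archimedean p = N , ℚ.toℚᵘ-cancel-≤ (begin
    toℚᵘ p          ≤⟨ p≤N p ⟩
    mkℚᵘ (ℤ.+ N) 0    ≃⟨ toℚᵘ-fromℕ N ⟨
    toℚᵘ (fromℕ N)  ∎)
    where
    open ℚᵘ.≤-Reasoning
    N : ℕ
    -- The denominator is at least 1, so the absolute value of the numerator is an upper bound.
    N = ℤ.∣ ↥ p ∣
    p≤N : ∀ q → toℚᵘ q ℚᵘ.≤ mkℚᵘ (ℤ.+ ℤ.∣ ↥ q ∣) 0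
    p≤N (mkℚ (ℤ.+ m) e _)    = *≤* (ℤ.*-monoˡ-≤-nonNeg (ℤ.+ m) (ℤ.+≤+ (s≤s (z≤n {e}))))
    p≤N (mkℚ -[1+ m ] e _) = *≤* (ℤ.≤-trans (ℤ.≤-reflexive (ℤ.*-identityʳ -[1+ m ])) ℤ.-≤+)

  hops : ∀ {n} {G : WGraph n} {u v} → Walk G u v → ℕ
  hops []      = 0
  hops (_ ∷ p) = suc (hops p)

  AtLeast1 : ∀ {n} → WGraph n → Set
  AtLeast1 G = ∀ u v x → G [ u — v ]≡ x → 1ℚ ≤ x

  module _ {n} {G : WGraph n} where

    _++ʷ_ : ∀ {u v t} → Walk G u v → Walk G v t → Walk G u t
    []      ++ʷ q = q
    (e ∷ p) ++ʷ q = e ∷ (p ++ʷ q)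

    length-++ʷ : ∀ {u v t} (p : Walk G u v) (q : Walk G v t) → length (p ++ʷ q) ≡ length p + length q
    length-++ʷ []                q = sym (ℚ.+-identityˡ (length q))
    length-++ʷ (_∷_ {x = x} _ p) q =
      trans (cong (x +_) (length-++ʷ p q)) (sym (ℚ.+-assoc x (length p) (length q)))

    hops≤length : AtLeast1 G → ∀ {u v} (p : Walk G u v) → fromℕ (hops p) ≤ length p
    hops≤length G≥1 [] = ℚ.≤-refl
    hops≤length G≥1 (_∷_ {x = x} e p) = begin
      fromℕ (suc (hops p))  ≡⟨ fromℕ-+ 1 (hops p) ⟩
      1ℚ + fromℕ (hops p)   ≤⟨ ℚ.+-mono-≤ (G≥1 _ _ x e) (hops≤length G≥1 p) ⟩
      x + length p          ∎
      where open ≤-Reasoning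

    -- Enumeration of bounded walks and existence of distances

    stays : ∀ u v → List (Walk G u v)
    stays u v with u ≟ᶠ v
    ... | yes refl = [] ∷ []
    ... | no _     = []

    -- The value of `weight?` comes with an equation, so that matching on it leaves the edge proof
    -- that `_∷_` needs.
    steps : ∀ {u v t} (m : Maybe ℚ) → weight? G u v ≡ m → List (Walk G v t) → List (Walk G u t)
    steps nothing  _ ps = []
    steps (just _) e ps = map (e ∷_) ps

    walks : ℕ → ∀ u v → List (Walk G u v)
    walks zero    u v = stays u v
    walks (suc N) u v =
      stays u v ++ List.concatMap (λ w → steps (weight? G u w) refl (walks N w v)) (List.allFin n)

    -- Only the length of the walk is recovered, so that proofs of
    -- edge-hood need not be compared.
    HasLengthOf : ∀ {u v} → Walk G u v → List (Walk G u v) → Set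
    HasLengthOf p ps = ∃[ q ] q ∈ ps × length q ≡ length p

    stays-complete : ∀ u → [] ∈ stays u u
    stays-complete u with u ≟ᶠ u
    ... | yes refl = here refl
    ... | no u≢u   = contradiction refl u≢u

    steps-complete : ∀ {u v t x} (e : G [ u — v ]≡ x) {p : Walk G v t} {ps} m (eq : weight? G u v ≡ m) →
                     HasLengthOf p ps → HasLengthOf (e ∷ p) (steps m eq ps)
    steps-complete e nothing  eq _ with () ← trans (sym e) eq
    steps-complete e {p} (just y) eq (q , q∈ , len) =
      eq ∷ q , ∈-map⁺ (eq ∷_) q∈ , cong₂ _+_ (just-injective (trans (sym eq) e)) len

    walks-complete : ∀ N {u v} (p : Walk G u v) → hops p ℕ.≤ N → HasLengthOf p (walks N u v)
    walks-complete zero    []      _ = [] , stays-complete _ , refl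
    walks-complete (suc N) []      _ = [] , ∈-++⁺ˡ (stays-complete _) , refl
    walks-complete (suc N) {u} {t} (_∷_ {v = v} e p) (s≤s hops≤N) =
      let q , q∈ , len = steps-complete e {p} (weight? G u v) refl (walks-complete N p hops≤N)
      in q , ∈-++⁺ʳ (stays u t) (∈-concat⁺′ q∈ (∈-map⁺ _ (∈-allFin v))) , len

    -- Walks with more edges than an upper bound on length p₀ are longer
    -- than p₀, so that only finitely many walks compete with p₀.
    distance-exists : AtLeast1 G → ∀ {u v} (p₀ : Walk G u v) →
                      ∃[ d ] IsDistance G u v d × d ≤ length p₀
    distance-exists G≥1 {u} {v} p₀ =
      length best , ((best , refl) , shortest) , f[argmin]≤f[⊤] {f = length} p₀ candidates
      where
      N : ℕ
      N = proj₁ (archimedean (length p₀))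
      candidates : List (Walk G u v)
      candidates = walks N u v
      best : Walk G u v
      best = argmin length p₀ candidates
      shortest : ∀ p → length best ≤ length p
      shortest p with hops p ℕ.≤? N
      ... | yes hops≤N = let q , q∈ , len = walks-complete N p hops≤N in
        ℚ.≤-trans (All.lookup (f[argmin]≤f[xs] {f = length} p₀ candidates) q∈) (ℚ.≤-reflexive len)
      ... | no hops≰N = begin
        length best     ≤⟨ f[argmin]≤f[⊤] {f = length} p₀ candidates ⟩
        length p₀       ≤⟨ proj₂ (archimedean (length p₀)) ⟩
        fromℕ N         ≤⟨ fromℕ-mono (ℕ.<⇒≤ (ℕ.≰⇒> hops≰N)) ⟩
        fromℕ (hops p)  ≤⟨ hops≤length G≥1 p ⟩
        length p        ∎
        where open ≤-Reasoning

    near⇒walk : ∀ {θ} → 0ℚ ≤ θ → ∀ {h u v} → Near (λ u v → ∃[ x ] G [ u — v ]≡ x × x ≤ θ) h u v →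
                Σ[ p ∈ Walk G u v ] length p ≤ fromℕ h * θ
    near⇒walk {θ} 0≤θ {h} stay = [] , ℚ.≤-trans (ℚ.≤-reflexive (sym (ℚ.*-zeroʳ (fromℕ h))))
      (ℚ.*-monoˡ-≤-nonNeg (fromℕ h) {{fromℕ-nonNeg h}} 0≤θ)
    near⇒walk {θ} 0≤θ {suc h} (step (x , e , x≤θ) near) = let p , len = near⇒walk 0≤θ near in
      e ∷ p , (begin
        x + length p           ≤⟨ ℚ.+-mono-≤ x≤θ len ⟩
        θ + fromℕ h * θ        ≡⟨ cong (_+ fromℕ h * θ) (ℚ.*-identityˡ θ) ⟨
        1ℚ * θ + fromℕ h * θ   ≡⟨ ℚ.*-distribʳ-+ θ 1ℚ (fromℕ h) ⟨
        (1ℚ + fromℕ h) * θ     ≡⟨ cong (_* θ) (fromℕ-+ 1 h) ⟨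
        fromℕ (suc h) * θ      ∎)
      where open ≤-Reasoning

  -- Stretch need only be checked on single edges: detours are concatenated along a walk and their
  -- lengths add up.
  replace-edges : ∀ {n} {G H : WGraph n} {α} →
    (∀ {u v x} → G [ u — v ]≡ x → Σ[ p ∈ Walk H u v ] length p ≤ α * x) →
    ∀ {u v} (p : Walk G u v) → Σ[ q ∈ Walk H u v ] length q ≤ α * length p
  replace-edges {α = α} f [] = [] , ℚ.≤-reflexive (sym (ℚ.*-zeroʳ α))
  replace-edges {α = α} f (_∷_ {x = x} e p) =
    let q , q≤ = f e
        r , r≤ = replace-edges {α = α} f p
    in q ++ʷ r , (begin
      length (q ++ʷ r)          ≡⟨ length-++ʷ q r ⟩
      length q + length r       ≤⟨ ℚ.+-mono-≤ q≤ r≤ ⟩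
      α * x + α * length p      ≡⟨ ℚ.*-distribˡ-+ α x (length p) ⟨
      α * (x + length p)        ∎)
    where open ≤-Reasoning

  subgraph-⊆ : ∀ {n} (G : WGraph n) E′ → subgraph G E′ ⊆ᴳ G
  subgraph-⊆ G E′ u v x e with member E′ u v
  ... | true  = e
  ... | false with () ← e

  subgraph-edge : ∀ {n} (G : WGraph n) E′ {u v x} → member E′ u v ≡ true → G [ u — v ]≡ x →
                  subgraph G E′ [ u — v ]≡ x
  subgraph-edge G E′ {u} {v} m e rewrite m = e

  -- A distance in the subgraph must be attained, not merely bounded. The concatenated detours show
  -- that a walk exists, and a shortest one is no longer.
  isSpanner : ∀ {n α} {G : WGraph n} {E′} → AtLeast1 G → E′ ⊆ᴱ G →
    (∀ {u v x} → G [ u — v ]≡ x → Σ[ p ∈ Walk (subgraph G E′) u v ] length p ≤ α * x) →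
    IsSpanner α G E′
  isSpanner {α = α} {G} {E′} G≥1 E′⊆G detour = E′⊆G , λ { u v _ ((p , refl) , _) →
    let q , q≤ = replace-edges {α = α} detour p
        d , dist , d≤q = distance-exists (λ u v x e → G≥1 u v x (subgraph-⊆ G E′ u v x e)) q
    in d , dist , ℚ.≤-trans d≤q q≤ }

-- The greedy protocol

module Protocols where

  open Counting
  open Distances
  open import Data.Nat as ℕ using (ℕ; zero; suc; z≤n; s≤s; _^_)
  import Data.Nat.Properties as ℕ
  open import Data.Rational using (ℚ; 0ℚ; _≤_; _≤?_; _*_; nonNegative)
  open import Data.Rational.Properties as ℚ using (module ≤-Reasoning)

  -- Sending numbers and edges bit by bit

  module _ {n s : ℕ} where

    -- The most significant bit is written first; composing `π` with `combine` rebuilds the number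
    -- on the way to the leaves.
    sendBits : ∀ b → Fin s → (WGraph n → Fin (2 ^ b)) → (Fin (2 ^ b) → Protocol n s) →
               Protocol n s
    sendBits zero    j f π = π Fin.zero
    sendBits (suc b) j f π =
      write j (Inverse.to 2↔Bool ∘ quotient (2 ^ b) ∘ f) λ bit →
        sendBits b j (remainder {2} (2 ^ b) ∘ f) (π ∘ combine (Inverse.from 2↔Bool bit))

    reassemble : ∀ b (i : Fin (2 ^ suc b)) →
      combine (Inverse.from 2↔Bool (Inverse.to 2↔Bool (quotient (2 ^ b) i))) (remainder {2} (2 ^ b) i) ≡ i
    reassemble b i = trans
      (cong (λ q → combine q (remainder {2} (2 ^ b) i)) (Inverse.strictlyInverseʳ 2↔Bool (quotient (2 ^ b) i)))
      (Fin.combine-remQuot {2} (2 ^ b) i)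

    result-sendBits : ∀ b j f π X → result (sendBits b j f π) X ≡ result (π (f (X j))) X
    result-sendBits zero j f π X with f (X j)
    ... | Fin.zero = refl
    result-sendBits (suc b) j f π X = trans (result-sendBits b j _ _ X)
      (cong (λ i → result (π i) X) (reassemble b (f (X j))))

    cost-sendBits : ∀ b j f π X → cost (sendBits b j f π) X ≡ b ℕ.+ cost (π (f (X j))) X
    cost-sendBits zero j f π X with f (X j)
    ... | Fin.zero = refl
    cost-sendBits (suc b) j f π X = cong suc (trans (cost-sendBits b j _ _ X)
      (cong (λ i → b ℕ.+ cost (π i) X) (reassemble b (f (X j)))))

  module _ {n : ℕ} where

    encode : Maybe (Fin n × Fin n) → Fin (suc (n ℕ.* n))
    encode nothing        = Fin.zero
    encode (just (u , v)) = Fin.suc (combine u v)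

    decode : Fin (suc (n ℕ.* n)) → Maybe (Fin n × Fin n)
    decode Fin.zero    = nothing
    decode (Fin.suc i) = just (remQuot n i)

    decode-encode : ∀ m → decode (encode m) ≡ m
    decode-encode nothing        = refl
    decode-encode (just (u , v)) = cong just (Fin.remQuot-combine u v)

  -- A left inverse of `inject≤`. Bit patterns out of range are never sent, and `Fin.zero` is an
  -- arbitrary default for them.
  truncate : ∀ {M N} → Fin N → Fin (suc M)
  truncate {M} i with toℕ i ℕ.<? suc M
  ... | yes i<M = fromℕ< i<M
  ... | no _    = Fin.zero

  truncate-inject≤ : ∀ {M N} (M<N : suc M ℕ.≤ N) (i : Fin (suc M)) → truncate (inject≤ i M<N) ≡ i
  truncate-inject≤ {M} M<N i with toℕ (inject≤ i M<N) ℕ.<? suc M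
  ... | yes p = Fin.toℕ-injective (trans (Fin.toℕ-fromℕ< p) (Fin.toℕ-inject≤ i M<N))
  ... | no ¬p = contradiction (subst (ℕ._< suc M) (sym (Fin.toℕ-inject≤ i M<N)) (Fin.toℕ<n i)) ¬p

  -- Scale `i` includes all lighter edges, so edges written at earlier scales can serve in detours
  -- at later ones.
  record Light {n} (G : WGraph n) (i : ℕ) (u v : Fin n) : Set where
    constructor light
    field
      {x}    : ℚ
      weight : G [ u — v ]≡ x
      bound  : x ≤ fromℕ (2 ^ i)

  light? : ∀ {n} (G : WGraph n) i → Decidable (Light G i)
  light? G i u v with weight? G u v in eq
  ... | nothing = no λ { (light e _) → contradiction (trans (sym e) eq) λ () }
  ... | just x  = map′ (light eq)
    (λ { (light e x≤) → subst (_≤ fromℕ (2 ^ i)) (just-injective (trans (sym e) eq)) x≤ })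
    (x ≤? fromℕ (2 ^ i))

  light-sym : ∀ {n} {G : WGraph n} {i u v} → Light G i u v → Light G i v u
  light-sym {G = G} (light e x≤) = light (trans (WGraph.sym G _ _) e) x≤

  light-mono : ∀ {n} {G : WGraph n} {i j u v} → i ℕ.≤ j → Light G i u v → Light G j u v
  light-mono i≤j (light e x≤) = light e (ℚ.≤-trans x≤ (fromℕ-mono (ℕ.^-monoʳ-≤ 2 i≤j)))

  listed? : ∀ {n} (F : List (Fin n × Fin n)) → Decidable (λ u v → (u , v) ∈ F)
  listed? F u v = any? (≡-dec _≟ᶠ_ _≟ᶠ_ (u , v)) F

  adj? : ∀ {n} (F : List (Fin n × Fin n)) → Decidable (Adj F)
  adj? F u v = listed? F u v ⊎-dec listed? F v u

  edgeSet : ∀ {n} → List (Fin n × Fin n) → EdgeSet n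
  edgeSet F = record
    { member = λ u v → does (adj? F u v)
    ; sym    = λ u v → ∨-comm (does (listed? F u v)) (does (listed? F v u))
    }

  edgeSet⁺ : ∀ {n} (F : List (Fin n × Fin n)) {u v} → Adj F u v → member (edgeSet F) u v ≡ true
  edgeSet⁺ F {u} {v} = dec-true (adj? F u v)

  edgeSet⁻ : ∀ {n} (F : List (Fin n × Fin n)) {u v} → member (edgeSet F) u v ≡ true → Adj F u v
  edgeSet⁻ F {u} {v} eq = invert (subst (Reflects (Adj F u v)) eq (proof (adj? F u v)))

  module Greedy-protocol {n s : ℕ} (h b : ℕ) (n²<2^b : suc (n ℕ.* n) ℕ.≤ 2 ^ b) where

    Candidate : WGraph n → ℕ → List (Fin n × Fin n) → Fin n × Fin n → Set
    Candidate X i F (u , v) = Light X i u v × ¬ Near (Adj F) h u v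

    candidate? : ∀ X i F → Dec (∃[ u ] ∃[ v ] Candidate X i F (u , v))
    candidate? X i F = Fin.any? λ u → Fin.any? λ v → light? X i u v ×-dec ¬? (near? (adj? F) h u v)

    choose : ℕ → List (Fin n × Fin n) → WGraph n → Maybe (Fin n × Fin n)
    choose i F X with candidate? X i F
    ... | yes (u , v , _) = just (u , v)
    ... | no _            = nothing

    -- The outcome of the search is replaced in the goal together with its justification, so that
    -- proofs about the protocol need not unfold `choose`.
    choose-elim : ∀ (P : Maybe (Fin n × Fin n) → Set) i F X →
      ((∀ {e} → ¬ Candidate X i F e) → P nothing) →
      (∀ {e} → Candidate X i F e → P (just e)) →
      P (choose i F X)
    choose-elim P i F X none found with candidate? X i F
    ... | yes (u , v , c) = found c
    ... | no ¬c           = none λ c → ¬c (_ , _ , c)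

    send : Fin s → (WGraph n → Maybe (Fin n × Fin n)) →
           (Maybe (Fin n × Fin n) → Protocol n s) → Protocol n s
    send j f π = sendBits b j (λ X → inject≤ (encode (f X)) n²<2^b) (π ∘ decode {n} ∘ truncate)

    transmit : ∀ m → decode {n} (truncate (inject≤ (encode m) n²<2^b)) ≡ m
    transmit m = trans (cong decode (truncate-inject≤ n²<2^b (encode m))) (decode-encode m)

    result-send : ∀ j f π X → result (send j f π) X ≡ result (π (f (X j))) X
    result-send j f π X = trans (result-sendBits b j _ _ X)
      (cong (λ m → result (π m) X) (transmit (f (X j))))

    cost-send : ∀ j f π X → cost (send j f π) X ≡ b ℕ.+ cost (π (f (X j))) X
    cost-send j f π X = trans (cost-sendBits b j _ _ X)
      (cong (λ m → b ℕ.+ cost (π m) X) (transmit (f (X j))))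

    -- A task (i , j) asks site j for edges of weight at most 2 ^ i whose
    -- endpoints are not near each other in F; m bounds the number of edges
    -- still to be added to F.
    run : ℕ → List (ℕ × Fin s) → List (Fin n × Fin n) → Protocol n s
    run m       []             F = output (edgeSet F)
    run zero    (_ ∷ _)        F = output (edgeSet F)
    run (suc m) ((i , j) ∷ ts) F =
      send j (choose i F) (maybe (λ e → run m ((i , j) ∷ ts) (e ∷ F)) (run (suc m) ts F))

    -- Each message takes `b` bits and either retires a task or uses up one unit of `m`.
    cost-run : ∀ m ts F X → cost (run m ts F) X ℕ.≤ (List.length ts ℕ.+ m) ℕ.* b
    cost-run m       []             F X = z≤n
    cost-run zero    (_ ∷ _)        F X = z≤n
    cost-run (suc m) ((i , j) ∷ ts) F X = begin
      cost (send j (choose i F) π) X        ≡⟨ cost-send j (choose i F) π X ⟩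
      b ℕ.+ cost (π (choose i F (X j))) X   ≤⟨ ℕ.+-monoʳ-≤ b (choose-elim
        (λ c → cost (π c) X ℕ.≤ (List.length ts ℕ.+ suc m) ℕ.* b) i F (X j)
        (λ _ → cost-run (suc m) ts F X)
        (λ {e} _ → ℕ.≤-trans (cost-run m ((i , j) ∷ ts) (e ∷ F) X)
          (ℕ.≤-reflexive (cong (ℕ._* b) (sym (ℕ.+-suc (List.length ts) m)))))) ⟩
      b ℕ.+ (List.length ts ℕ.+ suc m) ℕ.* b  ∎
      where
      open ℕ.≤-Reasoning
      π : Maybe (Fin n × Fin n) → Protocol n s
      π = maybe (λ e → run m ((i , j) ∷ ts) (e ∷ F)) (run (suc m) ts F)

    -- Correctness of the protocol

    module _ (T : ℕ) (greedy-≤T : ∀ {F : List (Fin n × Fin n)} → Greedy h F → List.length F ℕ.≤ T)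
             (D : DistributedGraph n s) where

      private
        G : WGraph n
        G = graph D

      Covered : List (Fin n × Fin n) → ℕ → Fin s → Set
      Covered F i j = ∀ {u v} → Light (site D j) i u v → Near (λ u v → Adj F u v × Light G i u v) h u v

      -- As tasks are sorted by scale, an edge that is light for the current task is light for all
      -- later ones; this is how `sorted` preserves `lights`.
      record Invariant (ts : List (ℕ × Fin s)) (F : List (Fin n × Fin n)) : Set where
        constructor invariant
        field
          sorted : AllPairs (λ t t′ → proj₁ t ℕ.≤ proj₁ t′) ts
          greedy : Greedy h F
          edges  : All (uncurry (Edge G)) F
          lights : All (λ t → All (uncurry (Light G (proj₁ t))) F) ts

      record Outcome (ts : List (ℕ × Fin s)) (F : List (Fin n × Fin n)) (E′ : EdgeSet n) : Set where
        constructor outcome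
        field
          F′      : List (Fin n × Fin n)
          E′≡     : E′ ≡ edgeSet F′
          F⊆F′    : ∀ {e} → e ∈ F → e ∈ F′
          edges   : All (uncurry (Edge G)) F′
          covered : ∀ {i j} → (i , j) ∈ ts → Covered F′ i j

      -- If no light edge of the site is far in `F`, then all of them are near by decidability. The
      -- bypass consists of edges of `F`, which are light, and it survives when `F` grows to `F′`.
      covered-if-none : ∀ {F F′ i j} → (∀ {e} → e ∈ F → e ∈ F′) → All (uncurry (Light G i)) F →
                        (∀ {e} → ¬ Candidate (site D j) i F e) → Covered F′ i j
      covered-if-none {F} F⊆F′ ls ¬c {u} {v} l = near-map
        (λ { (inj₁ e∈) → inj₁ (F⊆F′ e∈) , All.lookup ls e∈
           ; (inj₂ e∈) → inj₂ (F⊆F′ e∈) , light-sym (All.lookup ls e∈) })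
        (decidable-stable (near? (adj? F) h u v) (λ far → ¬c (l , far)))

      light-site : ∀ {j i u v} → Light (site D j) i u v → Light G i u v
      light-site (light e x≤) = light (DistributedGraph.site⊆ D _ _ _ _ e) x≤

      invariant-∷ : ∀ {i j ts F e} → Invariant ((i , j) ∷ ts) F → Candidate (site D j) i F e →
                    Invariant ((i , j) ∷ ts) (e ∷ F)
      invariant-∷ {ts = ts} {F} {e} (invariant (i≤ts ∷ sorted) greedy edges (ls ∷ lights)) (l , far) =
        invariant (i≤ts ∷ sorted) (far ∷ greedy) ((_ , Light.weight (light-site l)) ∷ edges)
          ((light-site l ∷ ls) ∷ extended i≤ts lights)
        where
        extended : ∀ {ts} → All (λ t → _ ℕ.≤ proj₁ t) ts →
                   All (λ t → All (uncurry (Light G (proj₁ t))) F) ts →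
                   All (λ t → All (uncurry (Light G (proj₁ t))) (e ∷ F)) ts
        extended []           []           = []
        extended (i≤t ∷ i≤ts) (ls ∷ lights) = (light-mono i≤t (light-site l) ∷ ls) ∷ extended i≤ts lights

      run-correct : ∀ m ts F → List.length F ℕ.+ m ≡ T → Invariant ts F →
                    Outcome ts F (result (run m ts F) (site D))
      run-correct m [] F len inv = outcome F refl id (Invariant.edges inv) λ ()
      -- The budget is spent, so `F` has `T` edges. A further candidate would give a greedy list
      -- longer than `T`; hence all remaining tasks are already covered.
      run-correct zero (t ∷ ts) F len (invariant _ greedy edges lights) =
        outcome F refl id edges λ t∈ → covered-if-none id (All.lookup lights t∈)
          (λ { (_ , far) → ℕ.<-irrefl (trans (sym (ℕ.+-identityʳ _)) len) (greedy-≤T (far ∷ greedy)) })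
      run-correct (suc m) ((i , j) ∷ ts) F len inv@(invariant (_ ∷ sorted) greedy es (ls ∷ lights)) =
        subst (Outcome ((i , j) ∷ ts) F) (sym (result-send j (choose i F) π (site D)))
          (choose-elim (λ c → Outcome ((i , j) ∷ ts) F (result (π c) (site D))) i F (site D j)
            (λ ¬c → let open Outcome (run-correct (suc m) ts F len (invariant sorted greedy es lights)) in
              outcome F′ E′≡ F⊆F′ edges
                λ { (here refl) → covered-if-none F⊆F′ ls ¬c ; (there t∈) → covered t∈ })
            (λ {e} c → let open Outcome (run-correct m ((i , j) ∷ ts) (e ∷ F)
                                  (trans (sym (ℕ.+-suc _ m)) len) (invariant-∷ inv c)) in
              outcome F′ E′≡ (F⊆F′ ∘ there) edges covered))
        where
        π : Maybe (Fin n × Fin n) → Protocol n s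
        π = maybe (λ e → run m ((i , j) ∷ ts) (e ∷ F)) (run (suc m) ts F)

      module _ {α β : ℕ} {ts : List (ℕ × Fin s)} (hβ≤α : h ℕ.* β ℕ.≤ α) (G≥1 : AtLeast1 G)
        (scale : ∀ {u v x} j → G [ u — v ]≡ x →
           ∃[ i ] (i , j) ∈ ts × x ≤ fromℕ (2 ^ i) × fromℕ (2 ^ i) ≤ fromℕ β * x)
        where

        -- The bypass has at most `h` edges, each of weight at most `2 ^ i`, which is at most `β x`.
        detour : ∀ {F u v x} → (∀ {i j} → (i , j) ∈ ts → Covered F i j) → G [ u — v ]≡ x →
                 Σ[ p ∈ Walk (subgraph G (edgeSet F)) u v ] length p ≤ fromℕ α * x
        detour {F} {u} {v} {x} covered e =
          let j , x′ , e′ = DistributedGraph.cover D u v (x , e)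
              x′≡x        = just-injective (trans (sym (DistributedGraph.site⊆ D j u v x′ e′)) e)
              i , t∈ , x≤θ , θ≤βx = scale j e
              p , p≤ = near⇒walk (fromℕ-mono (z≤n {2 ^ i})) (near-map
                (λ { (a , light {y} e″ y≤θ) → y , subgraph-edge G (edgeSet F) (edgeSet⁺ F a) e″ , y≤θ })
                (covered t∈ (light e′ (subst (_≤ fromℕ (2 ^ i)) (sym x′≡x) x≤θ))))
          in p , (begin
            length p                          ≤⟨ p≤ ⟩
            fromℕ h * fromℕ (2 ^ i)           ≤⟨ ℚ.*-monoˡ-≤-nonNeg (fromℕ h) {{fromℕ-nonNeg h}} θ≤βx ⟩
            fromℕ h * (fromℕ β * x)           ≡⟨ ℚ.*-assoc (fromℕ h) (fromℕ β) x ⟨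
            fromℕ h * fromℕ β * x             ≡⟨ cong (_* x) (fromℕ-* h β) ⟨
            fromℕ (h ℕ.* β) * x               ≤⟨ ℚ.*-monoʳ-≤-nonNeg x {{nonNegative 0≤x}} (fromℕ-mono hβ≤α) ⟩
            fromℕ α * x                       ∎)
          where
          open ≤-Reasoning
          0≤x : 0ℚ ≤ x
          0≤x = ℚ.≤-trans (fromℕ-mono (z≤n {1})) (G≥1 _ _ x e)

        edgeSet-⊆ : ∀ {F} → All (uncurry (Edge G)) F → edgeSet F ⊆ᴱ G
        edgeSet-⊆ {F} edges u v m with edgeSet⁻ F m
        ... | inj₁ e∈ = All.lookup edges e∈
        ... | inj₂ e∈ = let x , e = All.lookup edges e∈ in x , trans (WGraph.sym G u v) e

        outcome-spanner : ∀ {F E′} → Outcome ts F E′ → IsSpanner (fromℕ α) G E′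
        outcome-spanner (outcome F′ refl _ edges covered) =
          isSpanner {α = fromℕ α} {G} {edgeSet F′} G≥1 (edgeSet-⊆ edges) (detour covered)

-- Parameters and costs

module Complexity where

  open Counting
  open Distances
  open Protocols
  open import Data.Nat
  open import Data.Nat.Induction using (<-rec)
  open import Data.Nat.Logarithm using (⌈log₂_⌉; ⌈log₂⌉-mono-≤; ⌈log₂⌈n/2⌉⌉≡⌈log₂n⌉∸1)
  open import Data.Nat.Properties
  open import Data.Nat.Tactic.RingSolver using (solve-∀)
  import Data.Rational as ℚ
  import Data.Rational.Properties as ℚ

  -- Scales vary slowest: all sites finish one scale before the next begins.
  tasks : ℕ → ∀ s → List (ℕ × Fin s)
  tasks L s = List.cartesianProduct (List.upTo (suc L)) (List.allFin s)

  length-tasks : ∀ L s → List.length (tasks L s) ≡ suc L * s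
  length-tasks L s = trans (length-cartesianProduct (List.upTo (suc L)) (List.allFin s))
    (cong₂ _*_ (length-upTo (suc L)) (length-tabulate {n = s} id))

  ∈-tasks : ∀ {L s i} → i ≤ L → (j : Fin s) → (i , j) ∈ tasks L s
  ∈-tasks i≤L j = ∈-cartesianProduct⁺ (∈-upTo⁺ (s≤s i≤L)) (∈-allFin j)

  sorted-product : ∀ {B : Set} {xs} → AllPairs _≤_ xs → (ys : List B) →
                   AllPairs (_≤_ on proj₁) (List.cartesianProduct xs ys)
  sorted-product [] ys = []
  sorted-product {xs = x ∷ xs} (x≤xs ∷ sorted) ys =
    AllPairs.++⁺ (constant ys) (sorted-product sorted ys)
      (All.map⁺ (All.universal
        (λ _ → All.tabulate λ t∈ → All.lookup x≤xs (proj₁ (∈-cartesianProduct⁻ xs ys t∈))) ys))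
    where
    constant : ∀ ys → AllPairs (_≤_ on proj₁) (map (x ,_) ys)
    constant []       = []
    constant (y ∷ ys) = All.map⁺ (All.universal (λ _ → ≤-refl) ys) ∷ constant ys

  tasks-sorted : ∀ L s → AllPairs (_≤_ on proj₁) (tasks L s)
  tasks-sorted L s = sorted-product (AllPairs.applyUpTo⁺₁ id (suc L) (λ i<j _ → <⇒≤ i<j)) (List.allFin s)

  ^-distribʳ-* : ∀ k m n → (m * n) ^ k ≡ m ^ k * n ^ k
  ^-distribʳ-* zero    m n = refl
  ^-distribʳ-* (suc k) m n =
    trans (cong (m * n *_) (^-distribʳ-* k m n)) ([m*n]*[o*p]≡[m*o]*[n*p] m n (m ^ k) (n ^ k))

  n≤2^n : ∀ n → n ≤ 2 ^ n
  n≤2^n zero    = z≤n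
  n≤2^n (suc n) = begin
    suc n          ≤⟨ +-mono-≤ (m^n>0 2 n) (n≤2^n n) ⟩
    2 ^ n + 2 ^ n  ≡⟨ cong (2 ^ n +_) (+-identityʳ (2 ^ n)) ⟨
    2 ^ suc n      ∎
    where open ≤-Reasoning

  -- Strong induction: rounding `n / 2` up lowers the logarithm by one.
  n≤2^⌈log₂n⌉ : ∀ n → n ≤ 2 ^ ⌈log₂ n ⌉
  n≤2^⌈log₂n⌉ = <-rec (λ n → n ≤ 2 ^ ⌈log₂ n ⌉) λ
    { zero          _   → z≤n
    ; (suc zero)    _   → ≤-refl
    ; n@(suc (suc n-2)) rec → begin
        n                          ≡⟨ ⌊n/2⌋+⌈n/2⌉≡n n ⟨
        ⌊ n /2⌋ + ⌈ n /2⌉          ≤⟨ +-monoˡ-≤ ⌈ n /2⌉ (⌊n/2⌋≤⌈n/2⌉ n) ⟩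
        ⌈ n /2⌉ + ⌈ n /2⌉          ≡⟨ cong (⌈ n /2⌉ +_) (+-identityʳ ⌈ n /2⌉) ⟨
        2 * ⌈ n /2⌉                ≤⟨ *-monoʳ-≤ 2 (rec (⌈n/2⌉<n n-2)) ⟩
        2 ^ suc ⌈log₂ ⌈ n /2⌉ ⌉    ≡⟨ cong (λ l → 2 ^ suc l) (⌈log₂⌈n/2⌉⌉≡⌈log₂n⌉∸1 n) ⟩
        2 ^ suc (⌈log₂ n ⌉ ∸ 1)    ≡⟨ cong (2 ^_) (m+[n∸m]≡n {1} (⌈log₂⌉-mono-≤ {2} {n} (s≤s (s≤s z≤n)))) ⟩
        2 ^ ⌈log₂ n ⌉              ∎
    }
    where open ≤-Reasoning

  -- The integer `k`-th root, rounded so that `n` lies between consecutive powers; raising `n` by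
  -- one moves it by at most one.
  root : ∀ k .{{_ : NonZero k}} n → ∃[ e ] e ^ k ≤ n × n ≤ suc e ^ k
  root (suc k) zero = 0 , z≤n , z≤n
  root k (suc n) with root k n
  ... | e , e^k≤n , n≤[1+e]^k with suc n ≤? suc e ^ k
  ...   | yes 1+n≤ = e , m≤n⇒m≤1+n e^k≤n , 1+n≤
  ...   | no 1+n≰  =
    suc e , m≤n⇒m≤1+n (≤-pred (≰⇒> 1+n≰)) , ≤-<-trans n≤[1+e]^k (^-monoˡ-< k (n<1+n (suc e)))

  -- With κ + 1 ≤ 1 + ⌈log₂ n⌉, the factor κ + 1 in the bound on the number
  -- of edges is absorbed by the polylogarithmic factor.
  sparsity : ∀ k .{{_ : NonZero k}} n → ∃[ κ ] ∃[ d ] NonZero d × suc κ ≤ k × n ≤ d ^ suc κ ×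
             (suc κ * n * d) ^ k ≤ (2 * suc ⌈log₂ n ⌉) ^ k * n ^ suc k
  sparsity (suc k-1) zero = 0 , 1 , _ , s≤s z≤n , z≤n , z≤n
  sparsity k@(suc k-1) n@(suc _) with k ≤? suc ⌈log₂ n ⌉ | root k n
  -- For large `k` the exponent `1 + ⌈log₂ n⌉` takes its place, and base 2 suffices.
  ... | no k≰l | _ = ⌈log₂ n ⌉ , 2 , _ , <⇒≤ (≰⇒> k≰l) ,
      ≤-trans (n≤2^⌈log₂n⌉ n) (m≤m+n _ _) , (begin
        (l * n * 2) ^ k          ≡⟨ cong (_^ k) (trans (*-comm (l * n) 2) (sym (*-assoc 2 l n))) ⟩
        (2 * l * n) ^ k          ≡⟨ ^-distribʳ-* k (2 * l) n ⟩
        (2 * l) ^ k * n ^ k      ≤⟨ *-monoʳ-≤ ((2 * l) ^ k) (^-monoʳ-≤ n (n≤1+n k)) ⟩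
        (2 * l) ^ k * n ^ suc k  ∎)
    where
    open ≤-Reasoning
    l = suc ⌈log₂ n ⌉
  -- Here `d` is the integer root plus one, at most twice the real `k`-th root of `n`.
  ... | yes k≤l | e , e^k≤n , n≤[1+e]^k = k-1 , suc e , _ , ≤-refl , n≤[1+e]^k , (begin
        (k * n * suc e) ^ k              ≤⟨ ^-monoˡ-≤ k (*-monoˡ-≤ (suc e) (*-monoˡ-≤ n k≤l)) ⟩
        (l * n * suc e) ^ k              ≡⟨ ^-distribʳ-* k (l * n) (suc e) ⟩
        (l * n) ^ k * suc e ^ k          ≤⟨ *-monoʳ-≤ ((l * n) ^ k) (d^k≤ e e^k≤n) ⟩
        (l * n) ^ k * (2 ^ k * n)        ≡⟨ *-assoc ((l * n) ^ k) (2 ^ k) n ⟨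
        (l * n) ^ k * 2 ^ k * n          ≡⟨ cong (_* n) (^-distribʳ-* k (l * n) 2) ⟨
        (l * n * 2) ^ k * n              ≡⟨ cong (λ m → m ^ k * n) (trans (*-comm (l * n) 2) (sym (*-assoc 2 l n))) ⟩
        (2 * l * n) ^ k * n              ≡⟨ cong (_* n) (^-distribʳ-* k (2 * l) n) ⟩
        (2 * l) ^ k * n ^ k * n          ≡⟨ *-assoc ((2 * l) ^ k) (n ^ k) n ⟩
        (2 * l) ^ k * (n ^ k * n)        ≡⟨ cong ((2 * l) ^ k *_) (*-comm (n ^ k) n) ⟩
        (2 * l) ^ k * n ^ suc k          ∎)
    where
    open ≤-Reasoning
    l = suc ⌈log₂ n ⌉
    d^k≤ : ∀ e → e ^ k ≤ n → suc e ^ k ≤ 2 ^ k * n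
    d^k≤ zero    _      = ≤-trans (^-monoˡ-≤ k (n≤1+n 1)) (m≤m*n (2 ^ k) n)
    d^k≤ e@(suc e-1) e^k≤n = begin
      suc e ^ k        ≤⟨ ^-monoˡ-≤ k (≤-trans (s≤s (m≤n+m e e-1)) (≤-reflexive (cong (e +_) (sym (+-identityʳ e))))) ⟩
      (2 * e) ^ k      ≡⟨ ^-distribʳ-* k 2 e ⟩
      2 ^ k * e ^ k    ≤⟨ *-monoʳ-≤ (2 ^ k) e^k≤n ⟩
      2 ^ k * n        ∎

  -- Rounding a weight up to a power of two within the first `L + 1` scales costs at most a factor
  -- `β`.
  Scales : ∀ {n} → ℕ → ℕ → WGraph n → Set
  Scales β L G = ∀ {u v x} → G [ u — v ]≡ x →
    ∃[ i ] i ≤ L × x ℚ.≤ fromℕ (2 ^ i) × fromℕ (2 ^ i) ℚ.≤ fromℕ β ℚ.* x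

  -- Common form of both bounds: a bypass of `2k - 1` edges and the rounding factor `β` give stretch
  -- `β (2k - 1)`.
  spanner-complexity : ∀ δ (P : ∀ n → WGraph n → Set) (α : ℕ → ℕ) β A a →
    (∀ k → 1 < k → β * (2 * k ∸ 1) ≤ α k) →
    (∀ {n} {G : WGraph n} → P n G → AtLeast1 G × Scales β (A + a * ⌈log₂ n ⌉) G) →
    Õ⟨s+n^⟨1+1/k⟩⟩ (λ k n s → SpannerComplexity≤ δ n s (P n) (fromℕ (α k)))
  -- One logarithmic factor is due to the message length, at most `2l`. The other comes from the
  -- number of scales, at most `(A + a + 1) l`, or from the edge bound `T`, which contributes `2l`.
  spanner-complexity δ P α β A a α-large scales = 4 * suc (A + a) , 2 , bound
    where
    bound : ∀ k n s → 1 < k → ∃[ b ] SpannerComplexity≤ δ n s (P n) (fromℕ (α k)) b ×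
            b ≤ 4 * suc (A + a) * suc ⌈log₂ n ⌉ ^ 2 ·⟨ s + n ^⟨1+1/ k ⟩⟩
    bound k@(suc _) n s 1<k with κ , d , d≢0 , κ<k , n≤d^k , T^k≤ ← sparsity k n =
      (suc L * s + T) * B
      , ( run T (tasks L s) []
        , λ D _ G∈P →
            outcome-spanner T length≤T D hβ≤α (proj₁ (scales G∈P))
              (λ j e → let i , i≤L , bounds = proj₂ (scales G∈P) e in i , ∈-tasks i≤L j , bounds)
              (run-correct T length≤T D T (tasks L s) [] refl
                (invariant (tasks-sorted L s) [] [] (All.universal (λ _ → []) (tasks L s))))
          , subst (λ m → cost (run T (tasks L s) []) (site D) ≤ (m + T) * B) (length-tasks L s)
              (cost-run T (tasks L s) [] (site D)))
      , T * B , b≤ , t^k≤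
      where
      open ≤-Reasoning
      lg l h L T B M : ℕ
      lg = ⌈log₂ n ⌉
      l = suc lg
      h = suc (κ + κ)
      L = A + a * lg
      T = suc κ * n * d
      -- A message is one of `n * n` pairs or a refusal; the extra bit makes room for the refusal.
      B = suc (2 * lg)
      M = 4 * suc (A + a) * l ^ 2

      n²<2^B : suc (n * n) ≤ 2 ^ B
      n²<2^B = begin
        1 + n * n                            ≤⟨ +-mono-≤ (m^n>0 2 (2 * lg)) (*-mono-≤ (n≤2^⌈log₂n⌉ n) (n≤2^⌈log₂n⌉ n)) ⟩
        2 ^ (2 * lg) + 2 ^ lg * 2 ^ lg       ≡⟨ cong (2 ^ (2 * lg) +_) (^-distribˡ-+-* 2 lg lg) ⟨
        2 ^ (2 * lg) + 2 ^ (lg + lg)         ≡⟨ cong (λ m → 2 ^ (2 * lg) + 2 ^ (lg + m)) (+-identityʳ lg) ⟨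
        2 ^ (2 * lg) + 2 ^ (2 * lg)          ≡⟨ cong (2 ^ (2 * lg) +_) (+-identityʳ (2 ^ (2 * lg))) ⟨
        2 ^ B                                ∎

      open Greedy-protocol {n} {s} h B n²<2^B

      length≤T : ∀ {F} → Greedy h F → List.length F ≤ T
      length≤T = greedy-length κ d {{d≢0}} n≤d^k

      hβ≤α : h * β ≤ α k
      hβ≤α = begin
        h * β              ≡⟨ *-comm h β ⟩
        β * h              ≤⟨ *-monoʳ-≤ β (begin
          h                  ≡⟨ +-suc κ κ ⟨
          κ + suc κ          ≤⟨ +-mono-≤ (≤-pred κ<k) (≤-trans κ<k (≤-reflexive (sym (+-identityʳ k)))) ⟩
          2 * k ∸ 1          ∎) ⟩
        β * (2 * k ∸ 1)    ≤⟨ α-large k 1<k ⟩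
        α k                ∎

      B≤2l : B ≤ 2 * l
      B≤2l = ≤-trans (n≤1+n B) (≤-reflexive (sym (*-suc 2 lg)))

      L<Cl : suc L ≤ suc (A + a) * l
      L<Cl = begin
        suc (A + a * lg)                  ≤⟨ s≤s (+-mono-≤ (m≤m*n A l) (*-monoʳ-≤ a (n≤1+n lg))) ⟩
        1 + (A * l + a * l)               ≤⟨ +-monoˡ-≤ (A * l + a * l) (s≤s (z≤n {lg})) ⟩
        l + (A * l + a * l)               ≡⟨ cong (l +_) (*-distribʳ-+ l A a) ⟨
        suc (A + a) * l                   ∎

      b≤ : (suc L * s + T) * B ≤ M * s + T * B
      b≤ = begin
        (suc L * s + T) * B               ≡⟨ rearrange (suc L) s T B ⟩
        suc L * B * s + T * B             ≤⟨ +-monoˡ-≤ (T * B) (*-monoˡ-≤ s (begin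
          suc L * B                         ≤⟨ *-mono-≤ L<Cl B≤2l ⟩
          suc (A + a) * l * (2 * l)         ≤⟨ m≤m*n _ 2 ⟩
          suc (A + a) * l * (2 * l) * 2     ≡⟨ collect (suc (A + a)) l ⟩
          M                                 ∎)) ⟩
        M * s + T * B                     ∎
        where
        rearrange : ∀ L s T B → (L * s + T) * B ≡ L * B * s + T * B
        rearrange = solve-∀
        collect : ∀ c l → c * l * (2 * l) * 2 ≡ 4 * c * (l * (l * 1))
        collect = solve-∀

      t^k≤ : (T * B) ^ k ≤ M ^ k * n ^ suc k
      t^k≤ = begin
        (T * B) ^ k                            ≡⟨ ^-distribʳ-* k T B ⟩
        T ^ k * B ^ k                          ≤⟨ *-mono-≤ T^k≤ (^-monoˡ-≤ k B≤2l) ⟩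
        (2 * l) ^ k * n ^ suc k * (2 * l) ^ k  ≡⟨ swap-last ((2 * l) ^ k) (n ^ suc k) ⟩
        (2 * l) ^ k * (2 * l) ^ k * n ^ suc k  ≡⟨ cong (_* n ^ suc k) (^-distribʳ-* k (2 * l) (2 * l)) ⟨
        (2 * l * (2 * l)) ^ k * n ^ suc k      ≤⟨ *-monoˡ-≤ (n ^ suc k) (^-monoˡ-≤ k (begin
          2 * l * (2 * l)                        ≤⟨ m≤m*n _ (suc (A + a)) ⟩
          2 * l * (2 * l) * suc (A + a)          ≡⟨ collect (suc (A + a)) l ⟩
          M                                      ∎)) ⟩
        M ^ k * n ^ suc k                      ∎
        where
        swap-last : ∀ x y → x * y * x ≡ x * x * y
        swap-last = solve-∀
        collect : ∀ c l → 2 * l * (2 * l) * c ≡ 4 * c * (l * (l * 1))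
        collect = solve-∀

  -- Descend to the least scale that holds `x`. The scale below fails, so `2 ^ i` is at most `2x`;
  -- at scale 0 this follows from `x` being at least 1.
  dyadic-scale : ∀ L {x} → ℚ.1ℚ ℚ.≤ x → x ℚ.≤ fromℕ (2 ^ L) →
                 ∃[ i ] i ≤ L × x ℚ.≤ fromℕ (2 ^ i) × fromℕ (2 ^ i) ℚ.≤ fromℕ 2 ℚ.* x
  dyadic-scale zero {x} 1≤x x≤1 = 0 , z≤n , x≤1 ,
    ℚ.≤-trans (fromℕ-mono (n≤1+n 1)) (ℚ.*-monoˡ-≤-nonNeg (fromℕ 2) 1≤x)
  dyadic-scale (suc L) {x} 1≤x x≤ with x ℚ.≤? fromℕ (2 ^ L)
  ... | yes x≤2^L = let i , i≤L , bounds = dyadic-scale L 1≤x x≤2^L in i , m≤n⇒m≤1+n i≤L , bounds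
  ... | no x≰2^L  = suc L , ≤-refl , x≤ , ℚ.≤-trans (ℚ.≤-reflexive (fromℕ-* 2 (2 ^ L)))
    (ℚ.*-monoˡ-≤-nonNeg (fromℕ 2) (ℚ.<⇒≤ (ℚ.≰⇒> x≰2^L)))

-- Weighted and unweighted graphs

open Complexity
open Distances using (fromℕ-mono)
open import Data.Nat using (ℕ; _+_; _*_; _^_; _∸_; _≤_; z≤n; s≤s)
open import Data.Nat.Logarithm using (⌈log₂_⌉)
open import Data.Nat.Properties
open import Data.Rational using (ℚ)
import Data.Rational.Properties as ℚ

theorem2 :
    (∀ (δ : Duplication) (w : ℕ → ℚ) → PolynomiallyBounded w →
       Õ⟨s+n^⟨1+1/k⟩⟩ (λ k n s →
         SpannerComplexity≤ δ n s WeightsIn[1, w n ] (fromℕ (4 * k ∸ 2))))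
    ×
    (∀ (δ : Duplication) →
       Õ⟨s+n^⟨1+1/k⟩⟩ (λ k n s →
         SpannerComplexity≤ δ n s Unweighted (fromℕ (2 * k ∸ 1))))
theorem2 = weighted , unweighted
  where
  weighted : ∀ (δ : Duplication) (w : ℕ → ℚ) → PolynomiallyBounded w →
    Õ⟨s+n^⟨1+1/k⟩⟩ (λ k n s → SpannerComplexity≤ δ n s WeightsIn[1, w n ] (fromℕ (4 * k ∸ 2)))
  -- Dyadic rounding has `β = 2`, and twice `2k - 1` is `4k - 2`.
  weighted δ w (A , a , w≤) = spanner-complexity δ (λ n → WeightsIn[1, w n ]) (λ k → 4 * k ∸ 2) 2 A a
    (λ k _ → ≤-reflexive (trans (*-distribˡ-∸ 2 (2 * k) 1) (cong (_∸ 2) (sym (*-assoc 2 2 k)))))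
    (λ {n} G∈P → (λ u v x e → proj₁ (G∈P u v x e)) , λ {u} {v} {x} e →
      dyadic-scale (A + a * ⌈log₂ n ⌉) (proj₁ (G∈P u v x e))
        -- The bound on `w n` is given for positive `n` only; an endpoint of the edge shows that `n`
        -- is positive.
        (ℚ.≤-trans (proj₂ (G∈P u v x e)) (ℚ.≤-trans (w≤ n (vertex u)) (fromℕ-mono (A*n^a≤ n)))))
    where
    open ≤-Reasoning
    vertex : ∀ {n} → Fin n → 1 ≤ n
    vertex Fin.zero    = s≤s z≤n
    vertex (Fin.suc _) = s≤s z≤n
    A*n^a≤ : ∀ n → A * n ^ a ≤ 2 ^ (A + a * ⌈log₂ n ⌉)
    A*n^a≤ n = begin
      A * n ^ a                        ≤⟨ *-mono-≤ (n≤2^n A) (^-monoˡ-≤ a (n≤2^⌈log₂n⌉ n)) ⟩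
      2 ^ A * (2 ^ ⌈log₂ n ⌉) ^ a      ≡⟨ cong (2 ^ A *_) (^-*-assoc 2 ⌈log₂ n ⌉ a) ⟩
      2 ^ A * 2 ^ (⌈log₂ n ⌉ * a)      ≡⟨ cong (λ m → 2 ^ A * 2 ^ m) (*-comm ⌈log₂ n ⌉ a) ⟩
      2 ^ A * 2 ^ (a * ⌈log₂ n ⌉)      ≡⟨ ^-distribˡ-+-* 2 A (a * ⌈log₂ n ⌉) ⟨
      2 ^ (A + a * ⌈log₂ n ⌉)          ∎

  unweighted : ∀ (δ : Duplication) →
    Õ⟨s+n^⟨1+1/k⟩⟩ (λ k n s → SpannerComplexity≤ δ n s Unweighted (fromℕ (2 * k ∸ 1)))
  -- Scale 0 alone suffices and nothing is lost by rounding: `A` and `a` are 0, and `β` is 1.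
  unweighted δ = spanner-complexity δ (λ _ → Unweighted) (λ k → 2 * k ∸ 1) 1 0 0
    (λ k _ → ≤-reflexive (*-identityˡ (2 * k ∸ 1)))
    (λ G∈P → (λ u v x e → ℚ.≤-reflexive (sym (G∈P u v x e))) , λ {u} {v} {x} e →
      0 , z≤n , ℚ.≤-reflexive (G∈P u v x e) ,
      ℚ.≤-reflexive (trans (sym (G∈P u v x e)) (sym (ℚ.*-identityˡ x))))
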